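{- Let $G$ be a simple, undirected, finite graph and let $k$ be a positive integer. For every initial configuration $x(0)$ of the $k$-reversible process on $G$, the energy function $E$ is monotonically nondecreasing in time, i.e., $E(t+1)\geq E(t)$ for all integers $t\geq 0$.
   Context: Let $V(G)=\{v_1,\dots,v_n\}$. A configuration is an assignment of a state in $\{ -1,+1\}$ to each vertex. In the $k$-reversible process on $G$ with initial configuration $x(0)$, $x_i(t)$ denotes the state of $v_i$ at discrete time $t=0,1,2,\dots$. Let $\mathit{op}_i(t)$ be the number of neighbors of $v_i$ whose state at time $t$ is different from $x_i(t)$. All vertices are updated simultaneously: $x_i(t+1)=-x_i(t)$ if $\mathit{op}_i(t)\geq k$, and $x_i(t+1)=x_i(t)$ otherwise. Let $S_1(t)=\{v_i \mid \mathit{op}_i(t)\geq k\}$ and $S_2(t)=\{v_i\mid \mathit{op}_i(t)<k\}$. The energy function is $$E(t)=\sum_{v_i\in S_1(t)}(\mathit{op}_i(t)-k)+\sum_{v_i\in S_2(t)}(k-\mathit{op}_i(t)).$$ -}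

module Defs where

open import Data.Bool.Base using (if_then_else_)
open import Data.Fin.Base using (Fin)
open import Data.Integer.Base as ℤ using (ℤ; 0ℤ; +_)
open import Data.List.Base using (List; allFin; filter; foldr; length; map)
open import Data.Nat.Base using (ℕ; zero; suc)
open import Data.Nat.Properties using (_≤?_; _<?_)
open import Data.Sign using (Sign; opposite; _≟_)
open import Level using (0ℓ)
open import Relation.Binary.Core using (Rel)
open import Relation.Binary.Definitions using (Decidable; Irreflexive; Symmetric)
open import Relation.Binary.PropositionalEquality.Core using (_≡_)
open import Relation.Nullary.Decidable using (does; _×-dec_; ¬?)

-- Adjacency is required to be decidable so that neighbours can be counted
-- constructively.
record SimpleGraph (n : ℕ) : Set₁ where
  field
    Adj    : Rel (Fin n) 0ℓ
    adj?   : Decidable Adj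
    sym    : Symmetric Adj
    irrefl : Irreflexive _≡_ Adj

Configuration : ℕ → Set
Configuration n = Fin n → Sign

sumOver : {A : Set} → List A → (A → ℤ) → ℤ
sumOver xs f = foldr ℤ._+_ 0ℤ (map f xs)

module _ {n : ℕ} (G : SimpleGraph n) where
  open SimpleGraph G

  op : Configuration n → Fin n → ℕ
  op x i = length (filter (λ j → adj? i j ×-dec ¬? (x j ≟ x i)) (allFin n))

  module _ (k : ℕ) where

    step : Configuration n → Configuration n
    step x i = if does (k ≤? op x i) then opposite (x i) else x i

    state : Configuration n → ℕ → Configuration n
    state x₀ zero    = x₀
    state x₀ (suc t) = step (state x₀ t)

    S₁ : Configuration n → List (Fin n)
    S₁ x = filter (λ i → k ≤? op x i) (allFin n)

    S₂ : Configuration n → List (Fin n)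
    S₂ x = filter (λ i → op x i <? k) (allFin n)

    energyOf : Configuration n → ℤ
    energyOf x = sumOver (S₁ x) (λ i → + op x i ℤ.- + k)
           ℤ.+ sumOver (S₂ x) (λ i → + k ℤ.- + op x i)

    E : Configuration n → ℕ → ℤ
    E x₀ t = energyOf (state x₀ t)

{-# OPTIONS --safe #-}

-- For configurations x and y put F(x, y) = Σᵢ xᵢyᵢ(k − opᵢ(x)).  The energy of x
-- is Σᵢ |k − opᵢ(x)|, so F(x, y) ≤ energy(x) for every y, and the update rule
-- chooses the signs xᵢyᵢ that give equality at y = step(x).  Moreover F is
-- symmetric: since opᵢ(x) = Σ_{j ~ i} (1 − xᵢxⱼ)/2, we have
-- F(x, y) = Σᵢ xᵢyᵢ(k − deg(i)/2) + ½ Σ_{i ~ j} yᵢxⱼ.  Hence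
-- energy(x) = F(x, step x) = F(step x, x) ≤ energy(step x).
module Submission where

open import Defs
open import Data.Nat.Base as ℕ using (ℕ; suc; NonZero)
open import Data.Integer.Base using (_≥_)
open import Algebra.Properties.CommutativeSemigroup as CommutativeSemigroupProperties using ()
open import Data.Bool.Base using (Bool; true; false; _∧_; not; if_then_else_)
open import Data.Fin.Base using (Fin)
open import Data.Integer.Base as ℤ using (ℤ; 0ℤ; 1ℤ; +_; -[1+_]; ∣_∣; -_; _+_; _-_; _≤_; +≤+; -≤+)
open import Data.Integer.Properties as ℤ using ()
open import Data.List.Base using (List; []; _∷_; allFin; filter; length)
open import Data.Nat.Properties as ℕ using (_≤?_; _<?_)
open import Data.Sign as Sign using (Sign; opposite; _≟_)
open import Data.Sign.Properties as Sign using ()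
open import Relation.Nullary using (Dec; does; yes; no; contradiction)
open import Relation.Nullary.Decidable using (does-⇔; _×-dec_; ¬?)
open import Relation.Unary using (Pred; Decidable)
open import Relation.Binary.PropositionalEquality using (_≡_; refl; sym; trans; cong; cong₂; module ≡-Reasoning)
open import Function.Bundles using (mk⇔)
open import Level using (0ℓ)

open CommutativeSemigroupProperties ℤ.+-commutativeSemigroup using (interchange)

private variable
  A B : Set

-- Finite sums of integers.

sumOver-cong : (xs : List A) {f g : A → ℤ} → (∀ a → f a ≡ g a) → sumOver xs f ≡ sumOver xs g
sumOver-cong []       f≡g = refl
sumOver-cong (x ∷ xs) f≡g = cong₂ _+_ (f≡g x) (sumOver-cong xs f≡g)

sumOver-mono-≤ : (xs : List A) {f g : A → ℤ} → (∀ a → f a ≤ g a) → sumOver xs f ≤ sumOver xs g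
sumOver-mono-≤ []       f≤g = ℤ.≤-refl
sumOver-mono-≤ (x ∷ xs) f≤g = ℤ.+-mono-≤ (f≤g x) (sumOver-mono-≤ xs f≤g)

sumOver-0 : (xs : List A) → sumOver xs (λ _ → 0ℤ) ≡ 0ℤ
sumOver-0 []       = refl
sumOver-0 (_ ∷ xs) = trans (ℤ.+-identityˡ _) (sumOver-0 xs)

sumOver-+ : (xs : List A) (f g : A → ℤ) → sumOver xs (λ a → f a + g a) ≡ sumOver xs f + sumOver xs g
sumOver-+ []       f g = refl
sumOver-+ (x ∷ xs) f g = trans (cong (_+_ (f x + g x)) (sumOver-+ xs f g)) (interchange (f x) (g x) _ _)

sumOver-neg : (xs : List A) (f : A → ℤ) → sumOver xs (λ a → - f a) ≡ - sumOver xs f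
sumOver-neg []       f = refl
sumOver-neg (x ∷ xs) f = trans (cong (_+_ (- f x)) (sumOver-neg xs f)) (sym (ℤ.neg-distrib-+ (f x) _))

sumOver-comm : (xs : List A) (ys : List B) (f : A → B → ℤ) →
  sumOver xs (λ a → sumOver ys (f a)) ≡ sumOver ys (λ b → sumOver xs (λ a → f a b))
sumOver-comm []       ys f = sym (sumOver-0 ys)
sumOver-comm (x ∷ xs) ys f =
  trans (cong (_+_ (sumOver ys (f x))) (sumOver-comm xs ys f)) (sym (sumOver-+ ys (f x) _))

sumOver-filter : {P : Pred A 0ℓ} (P? : Decidable P) (xs : List A) (f : A → ℤ) →
  sumOver (filter P? xs) f ≡ sumOver xs (λ a → if does (P? a) then f a else 0ℤ)
sumOver-filter P? []       f = refl
sumOver-filter P? (x ∷ xs) f with does (P? x)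
... | true  = cong (_+_ (f x)) (sumOver-filter P? xs f)
... | false = trans (sumOver-filter P? xs f) (sym (ℤ.+-identityˡ _))

length≡sumOver : (xs : List A) → + length xs ≡ sumOver xs (λ _ → 1ℤ)
length≡sumOver []       = refl
length≡sumOver (_ ∷ xs) = cong (_+_ 1ℤ) (length≡sumOver xs)

double-injective : ∀ i j → i + i ≡ j + j → i ≡ j
double-injective i j eq = ℤ.*-cancelˡ-≡ (+ 2) i j (trans (2*≡+ i) (trans eq (sym (2*≡+ j))))
  where
  2*≡+ : ∀ i → + 2 ℤ.* i ≡ i + i
  2*≡+ i = trans (ℤ.*-distribʳ-+ i 1ℤ 1ℤ) (cong₂ _+_ (ℤ.*-identityˡ i) (ℤ.*-identityˡ i))

-- Exchanging the order of summation shows that twice a double sum is the double sum of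
-- `h a b + h b a`, and doubling is injective on integers. This allows two double sums to be
-- compared when only their symmetrized terms agree.
sumOver-symmetrized : (xs : List A) (f g : A → A → ℤ) →
  (∀ a b → f a b + f b a ≡ g a b + g b a) →
  sumOver xs (λ a → sumOver xs (f a)) ≡ sumOver xs (λ a → sumOver xs (g a))
sumOver-symmetrized {A} xs f g eq =
  double-injective _ _ (trans (doubled f) (trans (sumOver-cong xs λ a → sumOver-cong xs (eq a)) (sym (doubled g))))
  where
  doubled : (h : A → A → ℤ) →
    sumOver xs (λ a → sumOver xs (h a)) + sumOver xs (λ a → sumOver xs (h a)) ≡
    sumOver xs (λ a → sumOver xs (λ b → h a b + h b a))
  doubled h = begin
    ∑∑h + ∑∑h                                                ≡⟨ cong (_+_ ∑∑h) (sumOver-comm xs xs h) ⟩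
    ∑∑h + sumOver xs (λ a → sumOver xs (λ b → h b a))        ≡⟨ sumOver-+ xs _ _ ⟨
    sumOver xs (λ a → sumOver xs (h a) + sumOver xs (λ b → h b a)) ≡⟨ sumOver-cong xs (λ a → sumOver-+ xs (h a) (λ b → h b a)) ⟨
    sumOver xs (λ a → sumOver xs (λ b → h a b + h b a))      ∎
    where
    open ≡-Reasoning
    ∑∑h = sumOver xs (λ a → sumOver xs (h a))

-- Signs acting on integers, and the local identities.

infixr 8 _·_

_·_ : Sign → ℤ → ℤ
Sign.+ · i = i
Sign.- · i = - i

·-zero : ∀ s → s · 0ℤ ≡ 0ℤ
·-zero Sign.+ = refl
·-zero Sign.- = refl

·-distrib-- : ∀ s i j → s · (i - j) ≡ s · i - s · j
·-distrib-- Sign.+ i j = refl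
·-distrib-- Sign.- i j = ℤ.neg-distrib-+ i (- j)

·-sumOver : ∀ s (xs : List A) (f : A → ℤ) → s · sumOver xs f ≡ sumOver xs (λ a → s · f a)
·-sumOver Sign.+ xs f = refl
·-sumOver Sign.- xs f = sym (sumOver-neg xs f)

i≤+∣i∣ : ∀ i → i ≤ + ∣ i ∣
i≤+∣i∣ (+ _)    = ℤ.≤-refl
i≤+∣i∣ -[1+ _ ] = -≤+

s·i≤+∣i∣ : ∀ s i → s · i ≤ + ∣ i ∣
s·i≤+∣i∣ Sign.+ i = i≤+∣i∣ i
s·i≤+∣i∣ Sign.- i rewrite sym (ℤ.∣-i∣≡∣i∣ i) = i≤+∣i∣ (- i)

indicator : Bool → ℤ
indicator b = if b then 1ℤ else 0ℤ

-- The contribution of the ordered pair (i, j) to Σᵢ xᵢyᵢ opᵢ(x), where a tells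
-- whether i and j are adjacent, p = xᵢ, q = xⱼ and u = yᵢ.
pairTerm : Bool → Sign → Sign → Sign → ℤ
pairTerm a p q u = (p Sign.* u) · indicator (a ∧ not (does (q ≟ p)))

-- For `a` true the indicator is (1 - pq)/2, so by p² = q² = 1 the left side is (pu + qv - uq -
-- vp)/2, which is unchanged under exchanging (p, q) with (u, v). A single term gives (pu - uq)/2
-- and lacks this symmetry, so both orders of the pair are added.
pairTerm-exchange : ∀ a p q u v →
  pairTerm a p q u + pairTerm a q p v ≡ pairTerm a u v p + pairTerm a v u q
pairTerm-exchange false p q u v
  -- The indicators vanish, but `s · 0ℤ` does not reduce while `s` is a variable.
  rewrite ·-zero (p Sign.* u) | ·-zero (q Sign.* v) | ·-zero (u Sign.* p) | ·-zero (v Sign.* q) = refl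
pairTerm-exchange true Sign.+ Sign.+ Sign.+ Sign.+ = refl
pairTerm-exchange true Sign.+ Sign.+ Sign.+ Sign.- = refl
pairTerm-exchange true Sign.+ Sign.+ Sign.- Sign.+ = refl
pairTerm-exchange true Sign.+ Sign.+ Sign.- Sign.- = refl
pairTerm-exchange true Sign.+ Sign.- Sign.+ Sign.+ = refl
pairTerm-exchange true Sign.+ Sign.- Sign.+ Sign.- = refl
pairTerm-exchange true Sign.+ Sign.- Sign.- Sign.+ = refl
pairTerm-exchange true Sign.+ Sign.- Sign.- Sign.- = refl
pairTerm-exchange true Sign.- Sign.+ Sign.+ Sign.+ = refl
pairTerm-exchange true Sign.- Sign.+ Sign.+ Sign.- = refl
pairTerm-exchange true Sign.- Sign.+ Sign.- Sign.+ = refl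
pairTerm-exchange true Sign.- Sign.+ Sign.- Sign.- = refl
pairTerm-exchange true Sign.- Sign.- Sign.+ Sign.+ = refl
pairTerm-exchange true Sign.- Sign.- Sign.+ Sign.- = refl
pairTerm-exchange true Sign.- Sign.- Sign.- Sign.+ = refl
pairTerm-exchange true Sign.- Sign.- Sign.- Sign.- = refl

-- The product of `p` with its updated value is minus exactly when `k ≤ m`, that is, when `k - m` is
-- nonpositive. In the tie `k = m` the difference is zero and either sign would do.
threshold-sign : ∀ {k m} (k≤m? : Dec (k ℕ.≤ m)) p →
  (p Sign.* (if does k≤m? then opposite p else p)) · (+ k - + m) ≡ + ∣ + k - + m ∣
threshold-sign {k} {m} (yes k≤m) p rewrite Sign.s*opposite[s]≡- p = begin
  - (+ k - + m)         ≡⟨ ℤ.0≤i⇒+∣i∣≡i (ℤ.neg-mono-≤ (ℤ.i≤j⇒i-j≤0 (+≤+ k≤m))) ⟨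
  + ∣ - (+ k - + m) ∣   ≡⟨ cong +_ (ℤ.∣-i∣≡∣i∣ (+ k - + m)) ⟩
  + ∣ + k - + m ∣       ∎
  where open ≡-Reasoning
threshold-sign (no k≰m) p rewrite Sign.s*s≡+ p =
  sym (ℤ.0≤i⇒+∣i∣≡i (ℤ.i≤j⇒0≤j-i (+≤+ (ℕ.<⇒≤ (ℕ.≰⇒> k≰m)))))

-- The two decisions are separate arguments, but their propositions are complementary: exactly one
-- summand survives, and the two mixed cases are contradictory.
threshold-split : ∀ {k m} (k≤m? : Dec (k ℕ.≤ m)) (m<k? : Dec (m ℕ.< k)) →
  (if does k≤m? then + m - + k else 0ℤ) + (if does m<k? then + k - + m else 0ℤ) ≡ + ∣ + k - + m ∣
threshold-split (yes k≤m) (yes m<k) = contradiction k≤m (ℕ.<⇒≱ m<k)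
threshold-split {k} {m} (yes k≤m) (no _) = begin
  + m - + k + 0ℤ    ≡⟨ ℤ.+-identityʳ _ ⟩
  + m - + k         ≡⟨ ℤ.0≤i⇒+∣i∣≡i (ℤ.i≤j⇒0≤j-i (+≤+ k≤m)) ⟨
  + ∣ + m - + k ∣   ≡⟨ cong +_ (ℤ.∣i-j∣≡∣j-i∣ (+ m) (+ k)) ⟩
  + ∣ + k - + m ∣   ∎
  where open ≡-Reasoning
threshold-split (no _) (yes m<k) =
  trans (ℤ.+-identityˡ _) (sym (ℤ.0≤i⇒+∣i∣≡i (ℤ.i≤j⇒0≤j-i (+≤+ (ℕ.<⇒≤ m<k)))))
threshold-split (no k≰m) (no m≮k) = contradiction (ℕ.≰⇒> k≰m) m≮k

module _ {n : ℕ} (G : SimpleGraph n) where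
  open SimpleGraph G renaming (sym to Adj-sym)

  adj?-sym : ∀ i j → does (adj? i j) ≡ does (adj? j i)
  adj?-sym i j = does-⇔ (mk⇔ Adj-sym Adj-sym) (adj? i j) (adj? j i)

  opPair : Configuration n → Configuration n → Fin n → Fin n → ℤ
  opPair x y i j = pairTerm (does (adj? i j)) (x i) (x j) (y i)

  opPair-exchange : ∀ x y i j → opPair x y i j + opPair x y j i ≡ opPair y x i j + opPair y x j i
  -- Both orders of the pair must carry the same adjacency Boolean before `pairTerm-exchange`
  -- applies.
  opPair-exchange x y i j rewrite adj?-sym j i =
    pairTerm-exchange (does (adj? i j)) (x i) (x j) (y i) (y j)

  signed-op : ∀ x y i → (x i Sign.* y i) · + op G x i ≡ sumOver (allFin n) (opPair x y i)
  signed-op x y i = trans (cong ((x i Sign.* y i) ·_) op≡sumOver) (·-sumOver (x i Sign.* y i) (allFin n) _)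
    where
    opposed? = λ j → adj? i j ×-dec ¬? (x j ≟ x i)
    -- The Boolean of `opposed? j` unfolds to the conjunction inside `pairTerm`, so applying the
    -- sign to these terms yields `opPair x y i` definitionally.
    op≡sumOver : + op G x i ≡ sumOver (allFin n) (λ j → indicator (does (opposed? j)))
    op≡sumOver = trans (length≡sumOver (filter opposed? (allFin n))) (sumOver-filter opposed? (allFin n) _)

  sum-signed-op-sym : ∀ x y →
    sumOver (allFin n) (λ i → (x i Sign.* y i) · + op G x i) ≡
    sumOver (allFin n) (λ i → (y i Sign.* x i) · + op G y i)
  sum-signed-op-sym x y = begin
    sumOver (allFin n) (λ i → (x i Sign.* y i) · + op G x i)          ≡⟨ sumOver-cong (allFin n) (signed-op x y) ⟩
    sumOver (allFin n) (λ i → sumOver (allFin n) (opPair x y i))      ≡⟨ sumOver-symmetrized (allFin n) _ _ (opPair-exchange x y) ⟩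
    sumOver (allFin n) (λ i → sumOver (allFin n) (opPair y x i))      ≡⟨ sumOver-cong (allFin n) (signed-op y x) ⟨
    sumOver (allFin n) (λ i → (y i Sign.* x i) · + op G y i)          ∎
    where open ≡-Reasoning

  module _ (k : ℕ) where

    -- This is the form F(x, y).
    coupling : Configuration n → Configuration n → ℤ
    coupling x y = sumOver (allFin n) (λ i → (x i Sign.* y i) · (+ k - + op G x i))

    coupling-split : ∀ x y → coupling x y ≡
      sumOver (allFin n) (λ i → (x i Sign.* y i) · + k) - sumOver (allFin n) (λ i → (x i Sign.* y i) · + op G x i)
    coupling-split x y = begin
      coupling x y
        ≡⟨ sumOver-cong (allFin n) (λ i → ·-distrib-- (x i Sign.* y i) (+ k) (+ op G x i)) ⟩
      sumOver (allFin n) (λ i → (x i Sign.* y i) · + k - (x i Sign.* y i) · + op G x i)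
        ≡⟨ sumOver-+ (allFin n) _ _ ⟩
      ∑k + sumOver (allFin n) (λ i → - ((x i Sign.* y i) · + op G x i))
        ≡⟨ cong (_+_ ∑k) (sumOver-neg (allFin n) _) ⟩
      ∑k - sumOver (allFin n) (λ i → (x i Sign.* y i) · + op G x i)
        ∎
      where
      open ≡-Reasoning
      ∑k = sumOver (allFin n) (λ i → (x i Sign.* y i) · + k)

    -- The part with `k` is symmetric by commutativity of signs at each vertex; the part with `op`
    -- is symmetric only after summing over all vertices.
    coupling-sym : ∀ x y → coupling x y ≡ coupling y x
    coupling-sym x y = trans (coupling-split x y) (trans
      (cong₂ _-_ (sumOver-cong (allFin n) λ i → cong (_· + k) (Sign.*-comm (x i) (y i))) (sum-signed-op-sym x y))
      (sym (coupling-split y x)))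

    -- Each filter becomes an `if` with default `0ℤ`, so both sums run over all vertices and merge
    -- vertex by vertex.
    energyOf≡∑∣k-op∣ : ∀ x → energyOf G k x ≡ sumOver (allFin n) (λ i → + ∣ + k - + op G x i ∣)
    energyOf≡∑∣k-op∣ x = begin
      energyOf G k x
        ≡⟨ cong₂ _+_ (sumOver-filter (λ i → k ≤? op G x i) (allFin n) _) (sumOver-filter (λ i → op G x i <? k) (allFin n) _) ⟩
      sumOver (allFin n) (λ i → if does (k ≤? op G x i) then + op G x i - + k else 0ℤ) +
      sumOver (allFin n) (λ i → if does (op G x i <? k) then + k - + op G x i else 0ℤ)
        ≡⟨ sumOver-+ (allFin n) _ _ ⟨
      sumOver (allFin n) (λ i → (if does (k ≤? op G x i) then + op G x i - + k else 0ℤ) +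
                                (if does (op G x i <? k) then + k - + op G x i else 0ℤ))
        ≡⟨ sumOver-cong (allFin n) (λ i → threshold-split (k ≤? op G x i) (op G x i <? k)) ⟩
      sumOver (allFin n) (λ i → + ∣ + k - + op G x i ∣)
        ∎
      where open ≡-Reasoning

    coupling≤energyOf : ∀ x y → coupling x y ≤ energyOf G k x
    coupling≤energyOf x y rewrite energyOf≡∑∣k-op∣ x =
      sumOver-mono-≤ (allFin n) (λ i → s·i≤+∣i∣ (x i Sign.* y i) (+ k - + op G x i))

    coupling-step : ∀ x → coupling x (step G k x) ≡ energyOf G k x
    coupling-step x = trans (sumOver-cong (allFin n) λ i → threshold-sign (k ≤? op G x i) (x i)) (sym (energyOf≡∑∣k-op∣ x))

    -- An arbitrary configuration suffices here, since `state` at `suc t` is by definition one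
    -- `step` after `state` at `t`.
    energyOf-step : ∀ x → energyOf G k x ≤ energyOf G k (step G k x)
    energyOf-step x = begin
      energyOf G k x              ≡⟨ coupling-step x ⟨
      coupling x (step G k x)     ≡⟨ coupling-sym x (step G k x) ⟩
      coupling (step G k x) x     ≤⟨ coupling≤energyOf (step G k x) x ⟩
      energyOf G k (step G k x)   ∎
      where open ℤ.≤-Reasoning

lemma2 : (n : ℕ) (G : SimpleGraph n) (k : ℕ) .{{_ : NonZero k}} (x₀ : Configuration n) (t : ℕ) → E G k x₀ (suc t) ≥ E G k x₀ t
lemma2 n G k x₀ t = energyOf-step G k (state G k x₀ t)
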